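{- Let $V$ be a finite set and let $L\subseteq 2^V$ be upwards closed. A simplicial complex on $V$ generates $L$ if and only if its $1$-skeleton is $L$-connected. In other words, the minimal complexes generating $L$ are the minimal $L$-connected graphs on $V$ (minimality being with respect to inclusion).
   Context: All sets are finite. For $f:B^J\to A^I$ write $f_i(x)=f(x)_i$. For $i\in I$, the input window $\mathcal{W}_f(i)$ is the smallest set $W\subseteq J$ (it exists) such that for all $x,y\in B^J$, $x|_W=y|_W$ implies $f_i(x)=f_i(y)$. A simplicial complex (or complex) over (or on) a set $I$ is a collection of subsets of $I$, called its simplices, that is closed under taking subsets. The communication complex $K_f$ of $f$ is the complex over $I$ defined, for $S\subseteq I$, by: $S\in K_f$ iff $\bigcap_{i\in S}\mathcal{W}_f(i)\neq\emptyset$ (for $S=\emptyset$ the intersection is $J$). A complex $K$ over $I$ generates a language $L\subseteq A^I$ if there exist finite sets $B,J$ and a function $f:B^J\to A^I$ with image exactly $L$ and $K_f\subseteq K$. A complex generating $L$ is minimal if no complex strictly contained in it generates $L$. We identify $\{0,1\}^V$ with the powerset $2^V$ (a binary sequence is the characteristic function of a subset of $V$), so $L\subseteq 2^V$ is a language over the alphabet $\{0,1\}$. $L\subseteq 2^V$ is upwards closed if $U\in L$ and $U\subseteq U'\subseteq V$ imply $U'\in L$. The $1$-skeleton of a complex over $V$ is the set of edges (two-element simplices) belonging to that complex, seen as a graph on vertex set $V$. A graph on $V$ is regarded as a complex whose simplices are its vertices and edges (and the empty set). A graph is connected if its vertex set cannot be partitioned into two non-empty parts with no edge between them. A graph $G$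 on vertex set $V$ is $L$-connected if for every inclusion-maximal set $W\subseteq V$ with $W\notin L$, removing the vertices of $W$ from $G$ results in a connected graph.
   Formalization: The "if" direction and minimality are for complexes containing the empty set and every vertex of V; without this the claim fails (V={v}, L={∅,{v}}, K={∅}). L, complexes and graphs are given by decidable predicates, automatic classically. -}

module Defs where

open import Level using (0ℓ)
open import Data.Bool using (Bool)
open import Data.Empty using (⊥-elim)
open import Data.Nat using (ℕ; zero; suc)
open import Data.Fin using (Fin)
import Data.Fin.Properties as Fin
open import Data.Fin.Subset
  using (Subset; _∈_; _∉_; _⊆_; Nonempty; Empty; ⁅_⁆; _∪_; _∩_; _-_; ∁; ⊤; ⊥)
open import Data.Fin.Subset.Properties
  using (_∈?_; ∈⊤; ∉⊥; nonempty?; Empty-unique; x∈⁅x⁆; x∈⁅y⁆⇒x≡y; ∪-comm; x∈p∪q⁻; x∈p∪q⁺;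
         x∈p∩q⁺; x∈p∩q⁻; x∈p∧x≢y⇒x∈p-y; x∈p⇒p-x⊂p; ⊆-antisym)
open import Data.Fin.Subset.Induction using (⊂-wellFounded; Acc; acc)
open import Data.Vec using (Vec; []; _∷_; lookup; tabulate)
open import Data.Vec.Properties using (lookup∘tabulate; ≡-dec)
import Data.Bool.Properties as Bool
open import Data.Product using (Σ; ∃; ∃-syntax; _×_; _,_; proj₁; proj₂)
open import Data.Sum using (_⊎_; inj₁; inj₂)
open import Function using (_∘_)
open import Function.Bundles using (_⇔_)
open import Relation.Nullary using (¬_; Dec; yes; no)
open import Relation.Nullary.Decidable using (map′; ¬?; _×-dec_; _⊎-dec_; _→-dec_; decidable-stable)
import Relation.Unary as U
open import Relation.Unary using (Pred; Decidable)
import Relation.Binary as B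
open import Relation.Binary using (Rel; DecidableEquality)
open import Relation.Binary.PropositionalEquality
  using (_≡_; _≢_; refl; sym; trans; subst)

-- Finite index sets are the sets Fin n.  Collections of subsets, languages and
-- edge relations are decidable predicates, as every predicate on a finite set
-- is classically.

Language : Set → ℕ → Set₁
Language A n = Pred (Vec A n) 0ℓ

record Complex (n : ℕ) : Set₁ where
  field
    Simplex  : Pred (Subset n) 0ℓ
    simplex? : Decidable Simplex
    down     : ∀ {S T} → S ⊆ T → Simplex T → Simplex S

open Complex public using (Simplex; simplex?)

infix 4 _⊆ᶜ_ _⊂ᶜ_ _≐ᶜ_

_⊆ᶜ_ _⊂ᶜ_ _≐ᶜ_ : ∀ {n} → Complex n → Complex n → Set
K ⊆ᶜ K′ = Simplex K U.⊆ Simplex K′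
K ⊂ᶜ K′ = Simplex K U.⊂ Simplex K′
K ≐ᶜ K′ = Simplex K U.≐ Simplex K′

-- The vertex set of K is all of Fin n, as it is for a graph seen as a complex.
-- Without this, { ∅ } on one vertex would have an L-connected 1-skeleton for
-- L = { ∅ , V } but not generate L.  The condition on ⊥ only matters for n = 0,
-- where it excludes the collection with no simplex at all.
Spanning : ∀ {n} → Complex n → Set
Spanning K = Simplex K ⊥ × (∀ v → Simplex K ⁅ v ⁆)

allVec? : ∀ {b} m {P : Pred (Vec (Fin b) m) 0ℓ} → Decidable P → Dec (∀ x → P x)
allVec? zero    P? = map′ (λ { p [] → p }) (λ h → h []) (P? [])
allVec? (suc m) P? =
  map′ (λ { h (a ∷ x) → h a x }) (λ h a x → h (a ∷ x))
       (Fin.all? λ a → allVec? m λ x → P? (a ∷ x))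

module _ {A : Set} {b m n : ℕ} (f : Vec (Fin b) m → Vec A n) where

  AgreeOn : Subset m → Vec (Fin b) m → Vec (Fin b) m → Set
  AgreeOn W x y = ∀ j → j ∈ W → lookup x j ≡ lookup y j

  Determines : Fin n → Pred (Subset m) 0ℓ
  Determines i W = ∀ x y → AgreeOn W x y → lookup (f x) i ≡ lookup (f y) i

  IsWindow : Fin n → Pred (Subset m) 0ℓ
  IsWindow i W = Determines i W × (∀ W′ → Determines i W′ → W ⊆ W′)

  Determines-mono : ∀ {i W W′} → W ⊆ W′ → Determines i W → Determines i W′
  Determines-mono s d x y h = d x y λ j j∈W → h j (s j∈W)

  Determines-∩ : ∀ {i W W′} → Determines i W → Determines i W′ → Determines i (W ∩ W′)
  Determines-∩ {i} {W} {W′} d d′ x y h = trans (d x z x~z) (d′ z y z~y)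
    where
    pick : Fin m → Fin b
    pick j with j ∈? W
    ... | yes _ = lookup x j
    ... | no  _ = lookup y j

    z : Vec (Fin b) m
    z = tabulate pick

    x~z : AgreeOn W x z
    x~z j j∈W = trans eq (sym (lookup∘tabulate pick j))
      where
      eq : lookup x j ≡ pick j
      eq with j ∈? W
      ... | yes _  = refl
      ... | no j∉W = ⊥-elim (j∉W j∈W)

    z~y : AgreeOn W′ z y
    z~y j j∈W′ = trans (lookup∘tabulate pick j) eq
      where
      eq : pick j ≡ lookup y j
      eq with j ∈? W
      ... | yes j∈W = h j (x∈p∩q⁺ (j∈W , j∈W′))
      ... | no  _   = refl

  module _ (_≟_ : DecidableEquality A) where

    determines? : ∀ i → Decidable (Determines i)
    determines? i W = allVec? m λ x → allVec? m λ y →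
      Fin.all? (λ j → (j ∈? W) →-dec (lookup x j Fin.≟ lookup y j))
        →-dec (lookup (f x) i ≟ lookup (f y) i)

    shrink : ∀ i W → Acc Data.Fin.Subset._⊂_ W → Determines i W → ∃ (IsWindow i)
    shrink i W (acc rs) d
      with Fin.any? (λ j → (j ∈? W) ×-dec determines? i (W - j))
    ... | yes (j , j∈W , d′) = shrink i (W - j) (rs (x∈p⇒p-x⊂p j∈W)) d′
    ... | no  irreducible    = W , d , least
      where
      least : ∀ W′ → Determines i W′ → W ⊆ W′
      least W′ d′ {j} j∈W = decidable-stable (j ∈? W′) λ j∉W′ →
        irreducible (j , j∈W , Determines-mono (without j∉W′) (Determines-∩ d d′))
        where
        without : j ∉ W′ → W ∩ W′ ⊆ W - j
        without j∉W′ {k} k∈ with x∈p∩q⁻ W W′ k∈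
        ... | k∈W , k∈W′ = x∈p∧x≢y⇒x∈p-y k∈W λ { refl → j∉W′ k∈W′ }

    window-exists : ∀ i → ∃ (IsWindow i)
    window-exists i = shrink i ⊤ (⊂-wellFounded ⊤) λ x y h →
      subst (λ v → lookup (f x) i ≡ lookup (f v) i) (ext x y (λ j → h j ∈⊤)) refl
      where
      ext : ∀ {k} (x y : Vec (Fin b) k) → (∀ j → lookup x j ≡ lookup y j) → x ≡ y
      ext []      []      _ = refl
      ext (a ∷ x) (c ∷ y) h with h Fin.zero | ext x y (h ∘ Fin.suc)
      ... | refl | refl = refl

    window : Fin n → Subset m
    window i = proj₁ (window-exists i)

    communicationComplex : Complex n
    communicationComplex = record
      { Simplex  = λ S → ∃[ j ] (∀ i → i ∈ S → j ∈ window i)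
      ; simplex? = λ S → Fin.any? λ j → Fin.all? λ i → (i ∈? S) →-dec (j ∈? window i)
      ; down     = λ { S⊆T (j , h) → j , λ i i∈S → h i (S⊆T i∈S) }
      }

-- The equality test on the alphabet is only used to compute input windows.
Generates : ∀ {A : Set} {n} → DecidableEquality A → Complex n → Language A n → Set
Generates {A} {n} _≟_ K L =
  ∃[ b ] ∃[ m ] Σ (Vec (Fin b) m → Vec A n) λ f →
    (∀ u → L u ⇔ (∃[ x ] f x ≡ u)) × communicationComplex f _≟_ ⊆ᶜ K

MinimalGenerating : ∀ {A : Set} {n} → DecidableEquality A → Complex n → Language A n → Set₁
MinimalGenerating _≟_ K L =
  Spanning K × Generates _≟_ K L ×
  (∀ K′ → Spanning K′ → K′ ⊂ᶜ K → ¬ Generates _≟_ K′ L)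

record Graph (n : ℕ) : Set₁ where
  field
    Edge      : Rel (Fin n) 0ℓ
    edge?     : B.Decidable Edge
    symmetric : B.Symmetric Edge
    loopless  : ∀ {v} → ¬ Edge v v

open Graph public using (Edge; edge?)

infix 4 _⊂ᵍ_

_⊂ᵍ_ : ∀ {n} → Graph n → Graph n → Set
G ⊂ᵍ G′ = Edge G B.⇒ Edge G′ × ¬ (Edge G′ B.⇒ Edge G)

skeleton : ∀ {n} → Complex n → Graph n
skeleton K = record
  { Edge      = λ u v → u ≢ v × Simplex K (⁅ u ⁆ ∪ ⁅ v ⁆)
  ; edge?     = λ u v → ¬? (u Fin.≟ v) ×-dec simplex? K (⁅ u ⁆ ∪ ⁅ v ⁆)
  ; symmetric = λ { {u} {v} (u≢v , s) →
      (λ v≡u → u≢v (sym v≡u)) , subst (Simplex K) (∪-comm ⁅ u ⁆ ⁅ v ⁆) s }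
  ; loopless  = λ { (v≢v , _) → v≢v refl }
  }

graphComplex : ∀ {n} → Graph n → Complex n
graphComplex {n} G = record
  { Simplex  = Simp
  ; simplex? = λ S →
      (S ≟ˢ ⊥)
        ⊎-dec Fin.any? (λ v → S ≟ˢ ⁅ v ⁆)
        ⊎-dec Fin.any? (λ u → Fin.any? λ v → edge? G u v ×-dec (S ≟ˢ (⁅ u ⁆ ∪ ⁅ v ⁆)))
  ; down     = down
  }
  where
  _≟ˢ_ : DecidableEquality (Subset n)
  _≟ˢ_ = ≡-dec Bool._≟_

  Simp : Pred (Subset n) 0ℓ
  Simp S = S ≡ ⊥
         ⊎ (∃[ v ] S ≡ ⁅ v ⁆)
         ⊎ (∃[ u ] ∃[ v ] (Edge G u v × S ≡ ⁅ u ⁆ ∪ ⁅ v ⁆))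

  ⁅⁆⊆ : ∀ {v} {S : Subset n} → v ∈ S → ⁅ v ⁆ ⊆ S
  ⁅⁆⊆ {v} {S} v∈S x∈ = subst (_∈ S) (sym (x∈⁅y⁆⇒x≡y v x∈)) v∈S

  below-vertex : ∀ {S} v → S ⊆ ⁅ v ⁆ → Simp S
  below-vertex {S} v S⊆ with v ∈? S
  ... | yes v∈S = inj₂ (inj₁ (v , ⊆-antisym S⊆ (⁅⁆⊆ v∈S)))
  ... | no  v∉S = inj₁ (Empty-unique λ { (x , x∈S) →
                    v∉S (subst (_∈ S) (x∈⁅y⁆⇒x≡y v (S⊆ x∈S)) x∈S) })

  down : ∀ {S T} → S ⊆ T → Simp T → Simp S
  down S⊆T (inj₁ refl)              = inj₁ (Empty-unique λ { (_ , x∈S) → ∉⊥ (S⊆T x∈S) })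
  down S⊆T (inj₂ (inj₁ (v , refl))) = below-vertex v S⊆T
  down {S} S⊆T (inj₂ (inj₂ (u , v , e , refl))) with u ∈? S | v ∈? S
  ... | yes u∈S | yes v∈S = inj₂ (inj₂ (u , v , e , ⊆-antisym S⊆T back))
    where
    back : ⁅ u ⁆ ∪ ⁅ v ⁆ ⊆ S
    back x∈ with x∈p∪q⁻ ⁅ u ⁆ ⁅ v ⁆ x∈
    ... | inj₁ p = ⁅⁆⊆ u∈S p
    ... | inj₂ q = ⁅⁆⊆ v∈S q
  ... | no u∉S | _ = below-vertex v sub
    where
    sub : S ⊆ ⁅ v ⁆
    sub x∈S with x∈p∪q⁻ ⁅ u ⁆ ⁅ v ⁆ (S⊆T x∈S)
    ... | inj₁ p = ⊥-elim (u∉S (subst (_∈ S) (x∈⁅y⁆⇒x≡y u p) x∈S))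
    ... | inj₂ q = q
  ... | yes _ | no v∉S = below-vertex u sub
    where
    sub : S ⊆ ⁅ u ⁆
    sub x∈S with x∈p∪q⁻ ⁅ u ⁆ ⁅ v ⁆ (S⊆T x∈S)
    ... | inj₁ p = p
    ... | inj₂ q = ⊥-elim (v∉S (subst (_∈ S) (x∈⁅y⁆⇒x≡y v q) x∈S))

-- Connectedness of the subgraph of G induced on C; the empty graph is connected.
ConnectedOn : ∀ {n} → Graph n → Subset n → Set
ConnectedOn {n} G C =
  ¬ (Σ (Subset n) λ P → Σ (Subset n) λ Q →
       Nonempty P × Nonempty Q × P ∪ Q ≡ C × Empty (P ∩ Q) ×
       (∀ u v → u ∈ P → v ∈ Q → ¬ Edge G u v))

-- Subset n is Vec Bool n, so a language over {0,1} is a family of subsets.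

UpwardsClosed : ∀ {n} → Language Bool n → Set
UpwardsClosed L = ∀ U U′ → L U → U ⊆ U′ → L U′

MaximalNonMember : ∀ {n} → Language Bool n → Subset n → Set
MaximalNonMember L W = ¬ L W × (∀ W′ → ¬ L W′ → W ⊆ W′ → W′ ≡ W)

LConnected : ∀ {n} → Language Bool n → Graph n → Set
LConnected L G = ∀ W → MaximalNonMember L W → ConnectedOn G (∁ W)

MinimalLConnected : ∀ {n} → Language Bool n → Graph n → Set₁
MinimalLConnected L G = LConnected L G × (∀ G′ → G′ ⊂ᵍ G → ¬ LConnected L G′)

{-# OPTIONS --safe #-}
module Submission where

-- If K generates L through f, and the complement of a maximal W ∉ L splits into
-- P and Q with no edge of K between them, then no input is read both from P and
-- from Q.  Inputs producing W ∪ Q and W ∪ P exist by maximality of W; reading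
-- the first on the windows of P and the second elsewhere gives an output
-- contained in W, so W ∈ L.
--
-- Conversely, let every vertex and every edge carry an input whose values are
-- subsets of V.  A vertex v outputs 0 iff its own input is a set U ∈ L with
-- v ∉ U and all inputs on its incident edges are equal to U.  Adjacent vertices
-- that output 0 thus vote for the same U.  If the output were contained in a
-- maximal W ∉ L, then the connected complement of W would vote for a single
-- U ∈ L, and U ⊆ W.

open import Defs
open import Level using (0ℓ)
open import Data.Bool using (Bool; true; false)
open import Data.Bool.Properties using (_≟_)
open import Data.Empty using (⊥-elim)
open import Data.Fin using (Fin; combine; remQuot; funToFin; finToFun)
import Data.Fin.Properties as Fin
open import Data.Fin.Subset
  using (Subset; _∈_; _∉_; _⊆_; _⊃_; Nonempty; ⁅_⁆; _∪_; _∩_; ∁; ⊤; ⊥)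
open import Data.Fin.Subset.Induction using (⊃-wellFounded; Acc; acc)
open import Data.Fin.Subset.Properties
  using (_∈?_; ∈⊤; ∉⊥; nonempty?; ⊆-refl; ⊆-antisym; x∈⁅x⁆; x∈⁅y⁆⇒x≡y;
         x∈∁p⇒x∉p; x∉p⇒x∈∁p; p⊆p∪q; q⊆p∪q; x∈p∪q⁺; x∈p∪q⁻; x∈p∩q⁺; x∈p∩q⁻)
open import Data.Nat using (ℕ; _*_; _^_)
open import Data.Product using (∃-syntax; _×_; _,_; proj₁; proj₂)
open import Data.Sum using (_⊎_; inj₁; inj₂; [_,_]′)
open import Data.Vec using (Vec; _∷_; lookup; tabulate; replicate)
open import Data.Vec.Properties
  using (lookup∘tabulate; tabulate∘lookup; tabulate-cong; lookup-replicate; []=⇒lookup; lookup⇒[]=)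
open import Function using (_∘_)
open import Function.Bundles using (_⇔_; mk⇔; Equivalence; Inverse)
open import Relation.Binary using (_⇒_; DecidableEquality)
open import Relation.Binary.PropositionalEquality
  using (_≡_; _≢_; refl; sym; trans; cong; subst)
open import Relation.Nullary using (¬_; yes; no; does)
open import Relation.Nullary.Decidable
  using (¬?; _×-dec_; _⊎-dec_; _→-dec_; decidable-stable; dec-true; does-⇔)
open import Relation.Unary using (Pred; Decidable)

-- Subsets of a finite set

module _ {n : ℕ} {P : Pred (Fin n) 0ℓ} (P? : Decidable P) where

  filterᵛ : Subset n
  filterᵛ = tabulate (does ∘ P?)

  ∈-filterᵛ⁺ : ∀ {i} → P i → i ∈ filterᵛ
  ∈-filterᵛ⁺ {i} p =
    lookup⇒[]= i filterᵛ (trans (lookup∘tabulate _ i) (dec-true (P? i) p))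

  ∈-filterᵛ⁻ : ∀ {i} → i ∈ filterᵛ → P i
  ∈-filterᵛ⁻ {i} i∈
    with P? i | trans (sym (lookup∘tabulate (does ∘ P?) i)) ([]=⇒lookup i∈)
  ... | yes p | _ = p

∈-resp-lookup : ∀ {n} {U U′ : Subset n} {v} → lookup U v ≡ lookup U′ v → v ∈ U → v ∈ U′
∈-resp-lookup eq v∈U = lookup⇒[]= _ _ (trans (sym eq) ([]=⇒lookup v∈U))

∪-lub : ∀ {n} {p q r : Subset n} → p ⊆ r → q ⊆ r → p ∪ q ⊆ r
∪-lub p⊆r q⊆r = [ p⊆r , q⊆r ]′ ∘ x∈p∪q⁻ _ _

⁅⁆-⊆ : ∀ {n} {v : Fin n} {S} → v ∈ S → ⁅ v ⁆ ⊆ S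
⁅⁆-⊆ {v = v} {S} v∈S x∈ = subst (_∈ S) (sym (x∈⁅y⁆⇒x≡y v x∈)) v∈S

∈⁅⁆∪⁅⁆⁺ : ∀ {n} {u v x : Fin n} → x ≡ u ⊎ x ≡ v → x ∈ ⁅ u ⁆ ∪ ⁅ v ⁆
∈⁅⁆∪⁅⁆⁺ (inj₁ refl) = x∈p∪q⁺ (inj₁ (x∈⁅x⁆ _))
∈⁅⁆∪⁅⁆⁺ (inj₂ refl) = x∈p∪q⁺ (inj₂ (x∈⁅x⁆ _))

∈⁅⁆∪⁅⁆⁻ : ∀ {n} (u v : Fin n) {x} → x ∈ ⁅ u ⁆ ∪ ⁅ v ⁆ → x ≡ u ⊎ x ≡ v
∈⁅⁆∪⁅⁆⁻ u v x∈ with x∈p∪q⁻ ⁅ u ⁆ ⁅ v ⁆ x∈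
... | inj₁ p = inj₁ (x∈⁅y⁆⇒x≡y u p)
... | inj₂ q = inj₂ (x∈⁅y⁆⇒x≡y v q)

-- Maximal non-members of an upwards closed language

module _ {n : ℕ} {L : Language Bool n} (L? : Decidable L) (up : UpwardsClosed L) where

  -- Vertices are added one at a time while the set stays outside `L`. Once no single vertex can be
  -- added, upward closure puts every proper superset into `L`.
  extend-maximal : ∀ {U} → Acc _⊃_ U → ¬ L U →
                   ∃[ W ] (U ⊆ W × MaximalNonMember L W)
  extend-maximal {U} (acc rs) U∉L
    with Fin.any? (λ v → ¬? (v ∈? U) ×-dec ¬? (L? (U ∪ ⁅ v ⁆)))
  ... | yes (v , v∉U , U∪v∉L)
    with W , U∪v⊆W , max ← extend-maximal
           (rs (p⊆p∪q ⁅ v ⁆ , v , x∈p∪q⁺ (inj₂ (x∈⁅x⁆ v)) , v∉U)) U∪v∉L =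
    W , (λ u∈U → U∪v⊆W (p⊆p∪q ⁅ v ⁆ u∈U)) , max
  ... | no none = U , ⊆-refl , U∉L , maximal
    where
    maximal : ∀ W → ¬ L W → U ⊆ W → W ≡ U
    maximal W W∉L U⊆W = ⊆-antisym W⊆U U⊆W
      where
      W⊆U : W ⊆ U
      W⊆U {v} v∈W = decidable-stable (v ∈? U) λ v∉U →
        none (v , v∉U , λ U∪v∈L → W∉L (up _ W U∪v∈L (∪-lub U⊆W (⁅⁆-⊆ v∈W))))

  maximal-∪ : ∀ {W P v} → MaximalNonMember L W → v ∈ P → v ∉ W → L (W ∪ P)
  maximal-∪ {W} {P} (_ , maximal) v∈P v∉W = decidable-stable (L? (W ∪ P)) λ W∪P∉L →
    v∉W (subst (_ ∈_) (maximal (W ∪ P) W∪P∉L (p⊆p∪q P)) (q⊆p∪q W P v∈P))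

-- From generation to L-connectedness

module _ {A : Set} {b m n : ℕ} (f : Vec (Fin b) m → Vec A n) (_≟ᴬ_ : DecidableEquality A) where

  window-determines : ∀ i → Determines f i (window f _≟ᴬ_ i)
  window-determines i = proj₁ (proj₂ (window-exists f _≟ᴬ_ i))

  window-least : ∀ {i W} → Determines f i W → window f _≟ᴬ_ i ⊆ W
  window-least {i} = proj₂ (proj₂ (window-exists f _≟ᴬ_ i)) _

  -- Disjointness of the windows of P from those of Q is what lets an input be
  -- chosen independently for both.
  glue : ∀ {P Q : Subset n} →
         (∀ {u v j} → u ∈ P → v ∈ Q → j ∈ window f _≟ᴬ_ u → j ∉ window f _≟ᴬ_ v) →
         ∀ x y → ∃[ z ] ((∀ {u} → u ∈ P → lookup (f z) u ≡ lookup (f x) u) ×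
                         (∀ {v} → v ∈ Q → lookup (f z) v ≡ lookup (f y) v))
  glue {P} {Q} disjoint x y = tabulate pick , onP , onQ
    where
    readByP? : Decidable (λ j → ∃[ u ] (u ∈ P × j ∈ window f _≟ᴬ_ u))
    readByP? j = Fin.any? λ u → (u ∈? P) ×-dec (j ∈? window f _≟ᴬ_ u)

    pick : Fin m → Fin b
    pick j with readByP? j
    ... | yes _ = lookup x j
    ... | no  _ = lookup y j

    onP : ∀ {u} → u ∈ P → lookup (f (tabulate pick)) u ≡ lookup (f x) u
    onP {u} u∈P = window-determines u _ x λ j j∈ → trans (lookup∘tabulate pick j) (eq j j∈)
      where
      eq : ∀ j → j ∈ window f _≟ᴬ_ u → pick j ≡ lookup x j
      eq j j∈ with readByP? j
      ... | yes _  = refl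
      ... | no  ¬p = ⊥-elim (¬p (u , u∈P , j∈))

    onQ : ∀ {v} → v ∈ Q → lookup (f (tabulate pick)) v ≡ lookup (f y) v
    onQ {v} v∈Q = window-determines v _ y λ j j∈ → trans (lookup∘tabulate pick j) (eq j j∈)
      where
      eq : ∀ j → j ∈ window f _≟ᴬ_ v → pick j ≡ lookup y j
      eq j j∈ with readByP? j
      ... | yes (u , u∈P , j∈u) = ⊥-elim (disjoint u∈P v∈Q j∈u j∈)
      ... | no  _               = refl

generates⇒LConnected : ∀ {n} {L : Language Bool n} → Decidable L → UpwardsClosed L →
                       ∀ K → Generates _≟_ K L → LConnected L (skeleton K)
generates⇒LConnected {n} {L} L? up K (b , m , f , image , Kf⊆K)
  W max (P , Q , (p , p∈P) , (q , q∈Q) , P∪Q≡∁W , P∩Q≡∅ , no-edge) =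
  proj₁ max (up (f z) W (Equivalence.from (image (f z)) (z , refl)) fz⊆W)
  where
  P-avoids-W : ∀ {v} → v ∈ P → v ∉ W
  P-avoids-W v∈P = x∈∁p⇒x∉p (subst (_ ∈_) P∪Q≡∁W (x∈p∪q⁺ (inj₁ v∈P)))

  Q-avoids-W : ∀ {v} → v ∈ Q → v ∉ W
  Q-avoids-W v∈Q = x∈∁p⇒x∉p (subst (_ ∈_) P∪Q≡∁W (x∈p∪q⁺ (inj₂ v∈Q)))

  -- An input `j` in both windows would make the pair a simplex of the communication complex, hence
  -- an edge of `K` between `P` and `Q`.
  disjoint : ∀ {u v j} → u ∈ P → v ∈ Q → j ∈ window f _≟_ u → j ∉ window f _≟_ v
  disjoint {u} {v} {j} u∈P v∈Q j∈u j∈v = no-edge u v u∈P v∈Q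
    ( (λ { refl → P∩Q≡∅ (u , x∈p∩q⁺ (u∈P , v∈Q)) })
    , Kf⊆K (j , λ i i∈ → [ (λ { refl → j∈u }) , (λ { refl → j∈v }) ]′ (∈⁅⁆∪⁅⁆⁻ u v i∈)))

  preimage-W∪Q = Equivalence.to (image (W ∪ Q)) (maximal-∪ L? up max q∈Q (Q-avoids-W q∈Q))
  preimage-W∪P = Equivalence.to (image (W ∪ P)) (maximal-∪ L? up max p∈P (P-avoids-W p∈P))

  -- The preimage of `W ∪ Q` is used on `P` and that of `W ∪ P` on `Q`: each of these outputs is 0
  -- where it is used.
  glued = glue f _≟_ disjoint (proj₁ preimage-W∪Q) (proj₁ preimage-W∪P)
  z     = proj₁ glued

  fz⊆W : f z ⊆ W
  fz⊆W {v} v∈fz = decidable-stable (v ∈? W) λ v∉W → [ inP v∉W , inQ v∉W ]′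
    (x∈p∪q⁻ P Q (subst (v ∈_) (sym P∪Q≡∁W) (x∉p⇒x∈∁p v∉W)))
    where
    inP : v ∉ W → v ∉ P
    inP v∉W v∈P =
      [ v∉W , (λ v∈Q → P∩Q≡∅ (v , x∈p∩q⁺ (v∈P , v∈Q))) ]′
        (x∈p∪q⁻ W Q (subst (v ∈_) (proj₂ preimage-W∪Q)
          (∈-resp-lookup (proj₁ (proj₂ glued) v∈P) v∈fz)))

    inQ : v ∉ W → v ∉ Q
    inQ v∉W v∈Q =
      [ v∉W , (λ v∈P → P∩Q≡∅ (v , x∈p∩q⁺ (v∈P , v∈Q))) ]′
        (x∈p∪q⁻ W P (subst (v ∈_) (proj₂ preimage-W∪P)
          (∈-resp-lookup (proj₂ (proj₂ glued) v∈Q) v∈fz)))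

-- From L-connectedness to generation

-- If `g` took a second value on `C`, the level set of `g u` and the rest of `C` would be a
-- separation.
connected⇒constant : ∀ {n b} {G : Graph n} {C : Subset n} (g : Fin n → Fin b) →
                     (∀ {u v} → u ∈ C → v ∈ C → Edge G u v → g u ≡ g v) →
                     ConnectedOn G C → ∀ {u v} → u ∈ C → v ∈ C → g u ≡ g v
connected⇒constant {n} {b} {G} {C} g local connected {u} {v} u∈C v∈C =
  decidable-stable (g u Fin.≟ g v) λ gu≢gv → connected
    (P , Q , (u , ∈-filterᵛ⁺ inP? (u∈C , refl)) , (v , ∈-filterᵛ⁺ inQ? (v∈C , gu≢gv)) ,
     ⊆-antisym P∪Q⊆C C⊆P∪Q , empty , no-edge)
  where
  inP? : Decidable (λ w → w ∈ C × g u ≡ g w)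
  inP? w = (w ∈? C) ×-dec (g u Fin.≟ g w)

  inQ? : Decidable (λ w → w ∈ C × g u ≢ g w)
  inQ? w = (w ∈? C) ×-dec ¬? (g u Fin.≟ g w)

  P Q : Subset n
  P = filterᵛ inP?
  Q = filterᵛ inQ?

  P∪Q⊆C : P ∪ Q ⊆ C
  P∪Q⊆C = ∪-lub (proj₁ ∘ ∈-filterᵛ⁻ inP?) (proj₁ ∘ ∈-filterᵛ⁻ inQ?)

  C⊆P∪Q : C ⊆ P ∪ Q
  C⊆P∪Q {w} w∈C with g u Fin.≟ g w
  ... | yes eq = x∈p∪q⁺ (inj₁ (∈-filterᵛ⁺ inP? (w∈C , eq)))
  ... | no neq = x∈p∪q⁺ (inj₂ (∈-filterᵛ⁺ inQ? (w∈C , neq)))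

  empty : ¬ Nonempty (P ∩ Q)
  empty (w , w∈) with x∈p∩q⁻ P Q w∈
  ... | w∈P , w∈Q = proj₂ (∈-filterᵛ⁻ inQ? w∈Q) (proj₂ (∈-filterᵛ⁻ inP? w∈P))

  no-edge : ∀ s t → s ∈ P → t ∈ Q → ¬ Edge G s t
  no-edge s t s∈P t∈Q e with ∈-filterᵛ⁻ inP? s∈P | ∈-filterᵛ⁻ inQ? t∈Q
  ... | s∈C , gu≡gs | t∈C , gu≢gt = gu≢gt (trans gu≡gs (local s∈C t∈C e))

-- Input letters must come from some `Fin b`, so votes are stored as numbers whose `n` binary digits
-- are a characteristic function.
decode : ∀ {n} → Fin (2 ^ n) → Subset n
decode k = tabulate (Inverse.to Fin.2↔Bool ∘ finToFun k)

encode : ∀ {n} → Subset n → Fin (2 ^ n)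
encode U = funToFin (Inverse.from Fin.2↔Bool ∘ lookup U)

decode-encode : ∀ {n} (U : Subset n) → decode (encode U) ≡ U
decode-encode U = trans (tabulate-cong pointwise) (tabulate∘lookup U)
  where
  to∘from : ∀ c → Inverse.to Fin.2↔Bool (Inverse.from Fin.2↔Bool c) ≡ c
  to∘from true  = refl
  to∘from false = refl

  pointwise : ∀ i → Inverse.to Fin.2↔Bool (finToFun (encode U) i) ≡ lookup U i
  pointwise i =
    trans (cong (Inverse.to Fin.2↔Bool)
             (Fin.finToFun-funToFin (Inverse.from Fin.2↔Bool ∘ lookup U) i))
          (to∘from (lookup U i))

-- Entry (v , v) of the input is the private input of v; both (u , v) and (v , u)
-- are read by the two ends of an edge, and the remaining entries by nobody.
module Voting {n : ℕ} {L : Language Bool n} (L? : Decidable L) (up : UpwardsClosed L)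
              (G : Graph n) where

  Input : Set
  Input = Vec (Fin (2 ^ n)) (n * n)

  entry : Input → Fin n → Fin n → Fin (2 ^ n)
  entry x u v = lookup x (combine u v)

  vote : Input → Fin n → Subset n
  vote x v = decode (entry x v v)

  Zero : Input → Fin n → Set
  Zero x v = L (vote x v) × v ∉ vote x v ×
             (∀ w → Edge G v w → entry x v w ≡ entry x v v × entry x w v ≡ entry x v v)

  zero? : ∀ x → Decidable (Zero x)
  zero? x v = L? (vote x v) ×-dec ¬? (v ∈? vote x v) ×-dec
    Fin.all? λ w → edge? G v w →-dec
      ((entry x v w Fin.≟ entry x v v) ×-dec (entry x w v Fin.≟ entry x v v))

  one? : ∀ x → Decidable (¬_ ∘ Zero x)
  one? x v = ¬? (zero? x v)

  output : Input → Subset n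
  output x = filterᵛ (one? x)

  zero-outside : ∀ x {v} → v ∉ output x → Zero x v
  zero-outside x {v} v∉ = decidable-stable (zero? x v) (v∉ ∘ ∈-filterᵛ⁺ (one? x))

  -- An upper bound for the windows: a diagonal entry is read by its own vertex only, an edge entry
  -- by its two ends only.
  Reads : Fin n → Fin n × Fin n → Set
  Reads i (u , v) = (u ≡ v ⊎ Edge G u v) × (i ≡ u ⊎ i ≡ v)

  reads? : ∀ i → Decidable (Reads i)
  reads? i (u , v) =
    ((u Fin.≟ v) ⊎-dec edge? G u v) ×-dec ((i Fin.≟ u) ⊎-dec (i Fin.≟ v))

  support? : ∀ i → Decidable (Reads i ∘ remQuot n)
  support? i = reads? i ∘ remQuot n

  zero-resp : ∀ x y {i} → (∀ {u v} → Reads i (u , v) → entry x u v ≡ entry y u v) →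
              Zero x i → Zero y i
  zero-resp x y {i} same (vote∈L , i∉vote , agree) =
    subst (L ∘ decode) ii vote∈L , subst (λ k → i ∉ decode k) ii i∉vote , λ w e →
      trans (sym (same (inj₂ e , inj₁ refl))) (trans (proj₁ (agree w e)) ii) ,
      trans (sym (same (inj₂ (Graph.symmetric G e) , inj₂ refl))) (trans (proj₂ (agree w e)) ii)
    where
    ii : entry x i i ≡ entry y i i
    ii = same (inj₁ refl , inj₁ refl)

  output-determined : ∀ i → Determines output i (filterᵛ (support? i))
  output-determined i x y agree =
    trans (lookup∘tabulate _ i)
      (trans (does-⇔ (mk⇔ (_∘ zero-resp y x (sym ∘ same)) (_∘ zero-resp x y same)) (one? x i) (one? y i))
        (sym (lookup∘tabulate _ i)))
    where
    same : ∀ {u v} → Reads i (u , v) → entry x u v ≡ entry y u v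
    same {u} {v} r = agree (combine u v)
      (∈-filterᵛ⁺ (support? i) (subst (Reads i) (sym (Fin.remQuot-combine u v)) r))

  window⇒reads : ∀ {i j} → j ∈ window output _≟_ i → Reads i (remQuot n j)
  window⇒reads {i} j∈ =
    ∈-filterᵛ⁻ (support? i) (window-least output _≟_ (output-determined i) j∈)

  -- Every word of `L` is reached: when all entries encode `U`, the agreement test always passes and
  -- `v` outputs 0 exactly when it lies outside `U`.
  output-unanimous : ∀ {U} → L U → output (replicate _ (encode U)) ≡ U
  output-unanimous {U} U∈L = ⊆-antisym below above
    where
    x : Input
    x = replicate _ (encode U)

    const : ∀ u v → entry x u v ≡ encode U
    const u v = lookup-replicate (combine u v) (encode U)

    vote≡U : ∀ v → vote x v ≡ U
    vote≡U v = trans (cong decode (const v v)) (decode-encode U)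

    below : output x ⊆ U
    below {v} v∈ = decidable-stable (v ∈? U) λ v∉U → ∈-filterᵛ⁻ (one? x) v∈
      ( subst L (sym (vote≡U v)) U∈L
      , v∉U ∘ subst (v ∈_) (vote≡U v)
      , λ w _ → trans (const v w) (sym (const v v)) , trans (const w v) (sym (const v v)) )

    above : U ⊆ output x
    above {v} v∈U = ∈-filterᵛ⁺ (one? x) λ (_ , v∉ , _) → v∉ (subst (v ∈_) (sym (vote≡U v)) v∈U)

  output-∈ : L ⊤ → LConnected L G → ∀ x → L (output x)
  output-∈ ⊤∈L connected x = decidable-stable (L? (output x)) λ out∉L →
    let W , out⊆W , max = extend-maximal L? up (⊃-wellFounded (output x)) out∉L
    in  absurd W out⊆W max
    where
    absurd : ∀ W → output x ⊆ W → ¬ MaximalNonMember L W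
    absurd W out⊆W max with nonempty? (∁ W)
    -- With no vertex outside `W` nobody casts a vote; here `W` contains `⊤`, and `⊤∈L` gives the
    -- contradiction.
    ... | no  empty     = proj₁ max (up ⊤ W ⊤∈L λ {v} _ →
      decidable-stable (v ∈? W) λ v∉W → empty (v , x∉p⇒x∈∁p v∉W))
    ... | yes (c , c∈C) = proj₁ max (up (vote x c) W (proj₁ (zeroC c∈C)) vote⊆W)
      where
      zeroC : ∀ {v} → v ∈ ∁ W → Zero x v
      zeroC v∈C = zero-outside x (x∈∁p⇒x∉p v∈C ∘ out⊆W)

      -- Both ends compare their private entry with the shared entry `(u , v)`.
      local : ∀ {u v} → u ∈ ∁ W → v ∈ ∁ W → Edge G u v → entry x u u ≡ entry x v v
      local {u} {v} u∈C v∈C e =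
        trans (sym (proj₁ (proj₂ (proj₂ (zeroC u∈C)) v e)))
              (proj₂ (proj₂ (proj₂ (zeroC v∈C)) u (Graph.symmetric G e)))

      unanimous : ∀ {v} → v ∈ ∁ W → entry x c c ≡ entry x v v
      unanimous = connected⇒constant {G = G} (λ v → entry x v v) local (connected W max) c∈C

      -- A vertex outside `W` is missing from its own vote, which is also the vote of `c`.
      vote⊆W : vote x c ⊆ W
      vote⊆W {v} v∈vote = decidable-stable (v ∈? W) λ v∉W →
        let v∈C = x∉p⇒x∈∁p v∉W
        in  proj₁ (proj₂ (zeroC v∈C)) (subst (λ k → v ∈ decode k) (unanimous v∈C) v∈vote)

-- A map out of the empty type Vec (Fin 0) 1 has empty windows.
generates-empty : ∀ {n} {L : Language Bool n} K → Simplex K ⊥ → (∀ U → ¬ L U) →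
                  Generates _≟_ K L
generates-empty {n} {L} K ∅∈K empty =
  -- One coordinate rather than none: `Vec (Fin 0) 0` would contain `[]`.
  0 , 1 , f , (λ U → mk⇔ (⊥-elim ∘ empty U) λ { (() ∷ _ , _) }) ,
  λ (j , j∈) → Complex.down K
    (λ {i} i∈S → ⊥-elim (∉⊥ (window-least f _≟_ {i} {⊥} (λ { (() ∷ _) }) (j∈ i i∈S)))) ∅∈K
  where
  f : Vec (Fin 0) 1 → Subset n
  f (() ∷ _)

-- Voting needs `⊤` in `L`; an upwards closed `L` without `⊤` is empty.
LConnected⇒generates : ∀ {n} {L : Language Bool n} → Decidable L → UpwardsClosed L →
                       ∀ K → Spanning K → LConnected L (skeleton K) → Generates _≟_ K L
LConnected⇒generates {n} {L} L? up K (∅∈K , vertex∈K) connected with L? ⊤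
... | no  ⊤∉L = generates-empty K ∅∈K λ U U∈L → ⊤∉L (up U ⊤ U∈L λ _ → ∈⊤)
... | yes ⊤∈L = 2 ^ n , n * n , output ,
  (λ U → mk⇔ (λ U∈L → replicate _ (encode U) , output-unanimous U∈L)
              (λ { (x , refl) → output-∈ ⊤∈L connected x })) ,
  λ (j , j∈) → bounded (remQuot n j) λ i i∈S → window⇒reads (j∈ i i∈S)
  where
  open Voting L? up (skeleton K)

  -- The readers of one entry lie within a vertex, within an edge of `K`, or do not exist;
  -- `Spanning` supplies the first and last kind of simplex.
  bounded : ∀ {S} uv → (∀ i → i ∈ S → Reads i uv) → Simplex K S
  bounded (u , v) reads with u Fin.≟ v | edge? (skeleton K) u v
  ... | yes refl | _ = Complex.down K
    (λ {i} i∈S → [ (λ { refl → x∈⁅x⁆ u }) , (λ { refl → x∈⁅x⁆ u }) ]′ (proj₂ (reads i i∈S)))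
    (vertex∈K u)
  ... | no _   | yes (_ , uv∈K) = Complex.down K
    (λ {i} i∈S → ∈⁅⁆∪⁅⁆⁺ (proj₂ (reads i i∈S))) uv∈K
  ... | no u≢v | no ¬e = Complex.down K
    (λ {i} i∈S → ⊥-elim ([ u≢v , ¬e ]′ (proj₁ (reads i i∈S)))) ∅∈K

-- Minimal generating complexes and minimal L-connected graphs

LConnected-mono : ∀ {n} {L : Language Bool n} {G G′ : Graph n} →
                  Edge G ⇒ Edge G′ → LConnected L G → LConnected L G′
LConnected-mono G⊆G′ connected W max (P , Q , p , q , eq , empty , no-edge) =
  connected W max (P , Q , p , q , eq , empty , λ u v u∈P v∈Q → no-edge u v u∈P v∈Q ∘ G⊆G′)

skeleton-mono : ∀ {n} {K K′ : Complex n} → K ⊆ᶜ K′ → Edge (skeleton K) ⇒ Edge (skeleton K′)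
skeleton-mono K⊆K′ (u≢v , s) = u≢v , K⊆K′ s

graphComplex-spanning : ∀ {n} (G : Graph n) → Spanning (graphComplex G)
graphComplex-spanning G = inj₁ refl , λ v → inj₂ (inj₁ (v , refl))

graphComplex-⊆ : ∀ {n} {G : Graph n} {K : Complex n} → Spanning K →
                 Edge G ⇒ Edge (skeleton K) → graphComplex G ⊆ᶜ K
graphComplex-⊆ (∅∈K , _)    _   (inj₁ refl)                        = ∅∈K
graphComplex-⊆ (_ , vertex) _   (inj₂ (inj₁ (v , refl)))           = vertex v
graphComplex-⊆ _            G⊆K (inj₂ (inj₂ (u , v , e , refl))) = proj₂ (G⊆K e)

⇒skeleton-graphComplex : ∀ {n} (G : Graph n) → Edge G ⇒ Edge (skeleton (graphComplex G))
⇒skeleton-graphComplex G {u} {v} e =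
  (λ { refl → Graph.loopless G e }) , inj₂ (inj₂ (u , v , e , refl))

skeleton-graphComplex⇒ : ∀ {n} (G : Graph n) → Edge (skeleton (graphComplex G)) ⇒ Edge G
skeleton-graphComplex⇒ G {u} {v} (u≢v , s) = cases s (∈⁅⁆∪⁅⁆⁺ (inj₁ refl)) (∈⁅⁆∪⁅⁆⁺ (inj₂ refl))
  where
  -- Generalised to any `S` containing both vertices, so that the equation describing the simplex
  -- can be matched with `refl`.
  cases : ∀ {S} → Simplex (graphComplex G) S → u ∈ S → v ∈ S → Edge G u v
  cases (inj₁ refl) u∈ _ = ⊥-elim (∉⊥ u∈)
  cases (inj₂ (inj₁ (w , refl))) u∈ v∈ =
    ⊥-elim (u≢v (trans (x∈⁅y⁆⇒x≡y w u∈) (sym (x∈⁅y⁆⇒x≡y w v∈))))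
  cases (inj₂ (inj₂ (a , b , e , refl))) u∈ v∈ with ∈⁅⁆∪⁅⁆⁻ a b u∈ | ∈⁅⁆∪⁅⁆⁻ a b v∈
  ... | inj₁ refl | inj₁ refl = ⊥-elim (u≢v refl)
  ... | inj₁ refl | inj₂ refl = e
  ... | inj₂ refl | inj₁ refl = Graph.symmetric G e
  ... | inj₂ refl | inj₂ refl = ⊥-elim (u≢v refl)

module _ {n : ℕ} {L : Language Bool n} (L? : Decidable L) (up : UpwardsClosed L) where

  graphComplex-generates : ∀ {G} → LConnected L G → Generates _≟_ (graphComplex G) L
  graphComplex-generates {G} connected =
    LConnected⇒generates L? up (graphComplex G) (graphComplex-spanning G)
      (LConnected-mono {G = G} {G′ = skeleton (graphComplex G)} (⇒skeleton-graphComplex G) connected)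

  -- The skeleton of `K` is L-connected, so its graph complex already generates `L` inside `K`, and
  -- minimality makes the two equal. A smaller L-connected graph would likewise give a smaller
  -- generating complex.
  minimalGenerating⇒graph : ∀ K → MinimalGenerating _≟_ K L →
                            ∃[ G ] (MinimalLConnected L G × K ≐ᶜ graphComplex G)
  minimalGenerating⇒graph K (spanning , generates , minimal) =
    G , (connected , G-minimal) , K⊆G , G⊆K
    where
    G = skeleton K

    connected : LConnected L G
    connected = generates⇒LConnected L? up K generates

    G⊆K : graphComplex G ⊆ᶜ K
    G⊆K = graphComplex-⊆ {G = G} {K = K} spanning λ e → e

    K⊆G : K ⊆ᶜ graphComplex G
    K⊆G {S} S∈K = decidable-stable (simplex? (graphComplex G) S) λ S∉G →
      minimal (graphComplex G) (graphComplex-spanning G) (G⊆K , λ K⊆G → S∉G (K⊆G S∈K))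
        (graphComplex-generates {G} connected)

    G-minimal : ∀ G′ → G′ ⊂ᵍ G → ¬ LConnected L G′
    G-minimal G′ (G′⊆G , G⊈G′) connected′ =
      minimal (graphComplex G′) (graphComplex-spanning G′)
        ( graphComplex-⊆ {G = G′} {K = K} spanning G′⊆G
        , λ K⊆G′ → G⊈G′ (skeleton-graphComplex⇒ G′ ∘ skeleton-mono {K = K} {K′ = graphComplex G′} K⊆G′) )
        (graphComplex-generates {G′} connected′)

  graph⇒minimalGenerating : ∀ K → ∃[ G ] (MinimalLConnected L G × K ≐ᶜ graphComplex G) →
                            MinimalGenerating _≟_ K L
  graph⇒minimalGenerating K (G , (connected , G-minimal) , K⊆G , G⊆K) =
    spanning , generates , minimal
    where
    spanning : Spanning K
    spanning = G⊆K (inj₁ refl) , λ v → G⊆K (inj₂ (inj₁ (v , refl)))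

    generates : Generates _≟_ K L
    generates with b , m , f , image , Kf⊆G ← graphComplex-generates {G} connected =
      b , m , f , image , λ s → G⊆K (Kf⊆G s)

    minimal : ∀ K′ → Spanning K′ → K′ ⊂ᶜ K → ¬ Generates _≟_ K′ L
    minimal K′ spanning′ (K′⊆K , K⊈K′) generates′ =
      G-minimal (skeleton K′)
        ( skeleton-graphComplex⇒ G
            ∘ skeleton-mono {K = K′} {K′ = graphComplex G} (λ s → K⊆G (K′⊆K s))
        -- If the skeleton of `K′` contained all of `G`, then `K′`, being spanning, would contain
        -- the graph complex of `G` and hence `K`.
        , λ G⊆K′ → K⊈K′ λ s → graphComplex-⊆ {G = G} {K = K′} spanning′ G⊆K′ (K⊆G s) )
        (generates⇒LConnected L? up K′ generates′)

theorem3p1 : ∀ (n : ℕ) (L : Language Bool n) → Decidable L → UpwardsClosed L →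
    (∀ (K : Complex n) →
    (Generates _≟_ K L → LConnected L (skeleton K)) ×
    (Spanning K → LConnected L (skeleton K) → Generates _≟_ K L))
    ×
    (∀ (K : Complex n) →
    MinimalGenerating _≟_ K L ⇔
    (∃[ G ] (MinimalLConnected L G × K ≐ᶜ graphComplex G)))
theorem3p1 n L L? up =
  (λ K → generates⇒LConnected L? up K , LConnected⇒generates L? up K) ,
  (λ K → mk⇔ (minimalGenerating⇒graph L? up K) (graph⇒minimalGenerating L? up K))
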